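{- Let $G$ be a finite unweighted undirected graph with $n$ nodes, and let $H$ be the spanning subgraph of $G$ with all nodes of $G$ and no edges. Apply $2$-spanner-completion to $H$. Regardless of the choices made (of violating pairs and of shortest paths), the resulting graph $H$ has at most $O(n^{3/2})$ edges.
   Context: For a graph $F$ and nodes $u,v$, $d_F(u,v)$ denotes the length (number of edges) of a shortest path from $u$ to $v$ in $F$ ($\infty$ if none exists). A spanning subgraph $H$ of $G$ is an additive $k$-spanner of $G$ if $d_H(u,v) \le d_G(u,v)+k$ for every pair of nodes $u,v$. The procedure $k$-spanner-completion applied to a spanning subgraph $H$ of $G$ is: as long as there exists a pair of nodes $u,v$ with $d_H(u,v) > d_G(u,v)+k$, pick such a pair, find a shortest path from $u$ to $v$ in $G$, and add all edges of this path to $H$. When it terminates, $H$ is an additive $k$-spanner of $G$. The $O(\cdot)$ bound refers to an absolute constant independent of $G$ and $n$. -}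

module Defs where

open import Level using (0ℓ)
open import Data.Empty using (⊥)
open import Data.Fin using (Fin; _<?_)
open import Data.Fin.Properties using (_≟_)
open import Data.List using (List; []; _∷_; length; filter; cartesianProduct; allFin)
open import Data.List.Relation.Unary.Any using (here; there)
open import Data.Nat using (ℕ; _+_; _≤_; _<_)
open import Data.Product using (_×_; _,_; ∃-syntax; uncurry)
open import Data.Product.Properties using (≡-dec)
open import Data.Sum using (_⊎_; inj₁; inj₂; swap; map)
open import Relation.Binary using (Rel; Decidable; Symmetric; Irreflexive)
open import Relation.Binary.Construct.Add.Supremum.Strict _<_ using () renaming (_<⁺_ to _<∞_) public
open import Relation.Binary.Construct.Closure.ReflexiveTransitive using (Star; ε; _◅_)
open import Relation.Binary.PropositionalEquality using (_≡_; refl)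
open import Relation.Nullary using (¬_; yes; no)
open import Relation.Nullary.Construct.Add.Supremum using (_⁺; ⊤⁺; [_])
open import Relation.Nullary.Decidable using (_×-dec_; _⊎-dec_)

import Data.List.Membership.DecPropositional as Membership

record Graph (n : ℕ) : Set₁ where
  infix 4 _~_ _~?_
  field
    _~_    : Rel (Fin n) 0ℓ
    _~?_   : Decidable _~_
    sym    : Symmetric _~_
    irrefl : Irreflexive _≡_ _~_

open Graph

empty : ∀ n → Graph n
empty n = record
  { _~_    = λ _ _ → ⊥
  ; _~?_   = λ _ _ → no (λ ())
  ; sym    = λ ()
  ; irrefl = λ _ ()
  }

edgeCount : ∀ {n} → Graph n → ℕ
edgeCount {n} F =
  length (filter (uncurry (λ u v → (u <? v) ×-dec (_~?_ F u v)))
                 (cartesianProduct (allFin n) (allFin n)))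

-- Nodes may repeat along a path; on a shortest path they never do.
Path : ∀ {n} → Graph n → Rel (Fin n) 0ℓ
Path F = Star (_~_ F)

module _ {n : ℕ} {F : Graph n} where

  edges : ∀ {u v} → Path F u v → List (Fin n × Fin n)
  edges ε                   = []
  edges (_◅_ {x} {y} _ p) = (x , y) ∷ edges p

  pathLength : ∀ {u v} → Path F u v → ℕ
  pathLength p = length (edges p)

  IsShortest : ∀ {u v} → Path F u v → Set
  IsShortest {u} {v} p = (q : Path F u v) → pathLength p ≤ pathLength q

ℕ∞ : Set
ℕ∞ = ℕ ⁺

infixl 6 _+∞_
_+∞_ : ℕ∞ → ℕ → ℕ∞
[ d ] +∞ k = [ d + k ]
⊤⁺    +∞ k = ⊤⁺

-- IsDist F u v d means d_F(u,v) = d.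
IsDist : ∀ {n} → Graph n → Fin n → Fin n → ℕ∞ → Set
IsDist F u v [ d ] = ∃[ p ] IsShortest {F = F} {u} {v} p × pathLength {F = F} p ≡ d
IsDist F u v ⊤⁺    = ¬ Path F u v

Violates : ∀ {n} → ℕ → Graph n → Graph n → Fin n → Fin n → Set
Violates k G H u v =
  ∃[ dG ] ∃[ dH ] IsDist G u v dG × IsDist H u v dH × dG +∞ k <∞ dH

module _ {n : ℕ} where

  open Membership (≡-dec (_≟_ {n}) (_≟_ {n})) using (_∈_; _∈?_)

  Traverses : ∀ {G : Graph n} {u v} → Path G u v → Rel (Fin n) 0ℓ
  Traverses {G} p x y = (x , y) ∈ edges {F = G} p ⊎ (y , x) ∈ edges {F = G} p

  ∈-edges⇒~ : ∀ {G : Graph n} {u v x y} (p : Path G u v) →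
              (x , y) ∈ edges {F = G} p → _~_ G x y
  ∈-edges⇒~     (e ◅ p) (here refl) = e
  ∈-edges⇒~ {G} (e ◅ p) (there m)   = ∈-edges⇒~ {G} p m

  addPath : (G H : Graph n) → ∀ {u v} → Path G u v → Graph n
  addPath G H p = record
    { _~_    = λ x y → _~_ H x y ⊎ Traverses {G} p x y
    ; _~?_   = λ x y → _~?_ H x y ⊎-dec
                 (((x , y) ∈? edges {F = G} p) ⊎-dec ((y , x) ∈? edges {F = G} p))
    ; sym    = map (sym H) swap
    ; irrefl = λ { refl (inj₁ e)        → irrefl H refl e
                 ; refl (inj₂ (inj₁ m)) → irrefl G refl (∈-edges⇒~ {G} p m)
                 ; refl (inj₂ (inj₂ m)) → irrefl G refl (∈-edges⇒~ {G} p m) }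
    }

data Step {n} (k : ℕ) (G H : Graph n) : Graph n → Set where
  step : ∀ {u v} → Violates k G H u v →
         (p : Path G u v) → IsShortest {F = G} p →
         Step k G H (addPath G H p)

-- H′ is a possible result of k-spanner-completion applied to H: it is reached
-- by some sequence of choices, and no violating pair remains.
SpannerCompletion : ∀ {n} → ℕ → (G H H′ : Graph n) → Set₁
SpannerCompletion k G H H′ =
  Star (Step k G) H H′ × (∀ u v → ¬ Violates k G H′ u v)

{-# OPTIONS --safe #-}

-- Let Ψ(H) count the triples (a, x, j) with j < 3 for which H has a walk from a
-- to x of length at most d_G(a,x) + j; thus Ψ(H) ≤ 3n². Let H′ arise from H by
-- adding a shortest path p from u to v, and let N be the set of nodes adjacent
-- in H′ to some node of p. For x ∈ N, H′ has walks from u and v to x, each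
-- exceeding the distance in G by at most 2, of total length at most
-- d_G(u,v) + 2. They cannot both be matched in H, so
-- Ψ(H′) ≥ Ψ(H) + |N|. On the other hand a node has at most 3 neighbours on a
-- shortest path, so the degrees in H′ of the nodes of p sum to at most 3|N|,
-- each exceeding the one in H by at most 3; hence Σ deg² grows by at most
-- 6 · 3|N|. In the end Σ deg² ≤ 18 Ψ ≤ 54n², and Cauchy–Schwarz gives
-- (Σ deg)² ≤ 54n³.
module Submission where

open import Defs
open import Data.Fin using (Fin; zero; suc; toℕ; fromℕ<; _<?_)
open import Data.Fin.Properties using (_≟_; any?; toℕ-fromℕ<)
open import Data.List using (List; []; _∷_; _++_; map; length; filter; tabulate; cartesianProduct; allFin)
open import Data.List.Membership.Propositional using (_∈_; find; lose)
open import Data.List.Properties using (filter-++; length-++)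
open import Data.List.Relation.Unary.Any using (Any; here; there)
import Data.List.Relation.Unary.Any as Any
open import Data.Nat using (ℕ; zero; suc; _+_; _*_; _∸_; _^_; _≤_; _<_; z≤n; s≤s; _⊔_)
open import Data.Nat.ListAction renaming (sum to sumᴸ)
open import Data.Nat.Properties hiding (_≟_; _≤?_; _<?_)
open import Data.Nat.Tactic.RingSolver using (solve-∀)
open import Data.Product using (_×_; _,_; ∃-syntax; proj₁; proj₂)
open import Data.Sum using (_⊎_; inj₁; inj₂; [_,_]′)
open import Function using (_∘_; id)
open import Level using (0ℓ)
open import Relation.Binary using (Rel)
open import Relation.Binary.Construct.Closure.ReflexiveTransitive using (Star; ε; _◅_; _◅◅_)
open import Relation.Binary.PropositionalEquality using (_≡_; refl; cong; cong₂; subst; subst₂; trans; sym; module ≡-Reasoning)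
open import Relation.Nullary using (Dec; yes; no; ¬_; contradiction)
open import Relation.Nullary.Decidable using (map′; _×-dec_; _⊎-dec_)
open import Relation.Nullary.Construct.Add.Supremum using (⊤⁺; [_])
open import Relation.Binary.Construct.Add.Supremum.Strict _<_ using ([_]; [_]<⊤⁺)
open import Algebra.Properties.Semiring.Sum +-*-semiring
  using (sum; ∑-distrib-+; ∑-comm; *-distribˡ-sum)

import Data.List.Membership.DecPropositional as Membership

module G = Graph

private variable
  n : ℕ

-- Indicators and finite sums of natural numbers.

ind : {A : Set} → Dec A → ℕ
ind (yes _) = 1
ind (no _)  = 0

module _ {A B : Set} where

  ind-mono : (a? : Dec A) (b? : Dec B) → (A → B) → ind a? ≤ ind b?
  ind-mono (no _)  b?      f = z≤n
  ind-mono (yes a) (yes b) f = ≤-refl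
  ind-mono (yes a) (no ¬b) f = contradiction (f a) ¬b

  ind-strict : (a? : Dec A) (b? : Dec B) → ¬ A → B → ind a? < ind b?
  ind-strict (yes a) b?      ¬a b = contradiction a ¬a
  ind-strict (no _)  (yes _) ¬a b = ≤-refl
  ind-strict (no _)  (no ¬b) ¬a b = contradiction b ¬b

  ind-⊎ : ∀ {C : Set} (c? : Dec C) (a? : Dec A) (b? : Dec B) →
          (C → A ⊎ B) → ind c? ≤ ind a? + ind b?
  ind-⊎ (no _)  a?      b? f = z≤n
  ind-⊎ (yes c) (yes _) b?      f = s≤s z≤n
  ind-⊎ (yes c) (no _)  (yes _) f = ≤-refl
  ind-⊎ (yes c) (no ¬a) (no ¬b) f = contradiction (f c) [ ¬a , ¬b ]′

  ind-× : (a? : Dec A) (b? : Dec B) → ind (a? ×-dec b?) ≤ ind a? * ind b?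
  ind-× (no _)  b?      = z≤n
  ind-× (yes _) (yes _) = ≤-refl
  ind-× (yes _) (no _)  = z≤n

ind≤1 : {A : Set} (a? : Dec A) → ind a? ≤ 1
ind≤1 (yes _) = ≤-refl
ind≤1 (no _)  = z≤n

∑-mono : {f g : Fin n → ℕ} → (∀ i → f i ≤ g i) → sum f ≤ sum g
∑-mono {zero}  f≤g = z≤n
∑-mono {suc n} f≤g = +-mono-≤ (f≤g zero) (∑-mono (f≤g ∘ suc))

∑-strict : {f g : Fin n → ℕ} → (∀ i → f i ≤ g i) → ∀ i → f i < g i → sum f < sum g
∑-strict f≤g zero    lt = +-mono-<-≤ lt (∑-mono (f≤g ∘ suc))
∑-strict f≤g (suc i) lt = +-mono-≤-< (f≤g zero) (∑-strict (f≤g ∘ suc) i lt)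

∑-bound : ∀ {k} {f : Fin n → ℕ} → (∀ i → f i ≤ k) → sum f ≤ n * k
∑-bound {zero}  f≤k = z≤n
∑-bound {suc n} f≤k = +-mono-≤ (f≤k zero) (∑-bound (f≤k ∘ suc))

∑-zero : {f : Fin n → ℕ} → (∀ i → f i ≤ 0) → sum f ≤ 0
∑-zero {n} f≤0 = ≤-trans (∑-bound f≤0) (≤-reflexive (*-zeroʳ n))

∑-point : (a : Fin n) (f : Fin n → ℕ) → sum (λ w → ind (w ≟ a) * f w) ≤ f a
∑-point zero f = begin
  f zero + 0 + sum (λ w → ind (suc w ≟ zero) * f (suc w))
    ≤⟨ +-monoʳ-≤ (f zero + 0) (∑-zero {f = λ w → ind (suc w ≟ zero) * f (suc w)} λ _ → z≤n) ⟩
  f zero + 0 + 0   ≡⟨ trans (+-identityʳ _) (+-identityʳ _) ⟩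
  f zero ∎
  where open ≤-Reasoning
∑-point (suc a) f = ≤-trans (∑-mono λ w → *-monoˡ-≤ (f (suc w)) (ind-mono (suc w ≟ suc a) (w ≟ a) λ { refl → refl }))
                            (∑-point a (f ∘ suc))

∑-allFin : (f : Fin n → ℕ) → sumᴸ (map f (allFin n)) ≡ sum f
∑-allFin f = go f id
  where
  go : ∀ {m k} (f : Fin k → ℕ) (g : Fin m → Fin k) → sumᴸ (map f (tabulate g)) ≡ sum (f ∘ g)
  go {zero}  f g = refl
  go {suc m} f g = cong (f (g zero) +_) (go f (g ∘ suc))

-- The Cauchy-Schwarz inequality.

-- With the larger number written as the smaller plus `d`, the two sides differ by exactly `d * d`.
ab≤a²+b² : ∀ a b → 2 * (a * b) ≤ a * a + b * b
ab≤a²+b² a b with ≤-total a b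
... | inj₁ a≤b = subst (λ b → 2 * (a * b) ≤ a * a + b * b) (m+[n∸m]≡n a≤b) (lemma a (b ∸ a))
  where
  lemma : ∀ a d → 2 * (a * (a + d)) ≤ a * a + (a + d) * (a + d)
  lemma a d = ≤-trans (m≤m+n _ (d * d)) (≤-reflexive (eq a d))
    where
    eq : ∀ a d → 2 * (a * (a + d)) + d * d ≡ a * a + (a + d) * (a + d)
    eq = solve-∀
... | inj₂ b≤a = subst (λ a → 2 * (a * b) ≤ a * a + b * b) (m+[n∸m]≡n b≤a) (lemma b (a ∸ b))
  where
  lemma : ∀ b d → 2 * ((b + d) * b) ≤ (b + d) * (b + d) + b * b
  lemma b d = ≤-trans (m≤m+n _ (d * d)) (≤-reflexive (eq b d))
    where
    eq : ∀ b d → 2 * ((b + d) * b) + d * d ≡ (b + d) * (b + d) + b * b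
    eq = solve-∀

-- Induction on the number of terms: the mixed products of the first term with the others are
-- absorbed by summing `ab≤a²+b²` over them.
cauchy-schwarz : (f : Fin n → ℕ) → sum f * sum f ≤ n * sum (λ i → f i * f i)
cauchy-schwarz {zero}  f = z≤n
cauchy-schwarz {suc n} f = begin
  (a + S) * (a + S)                     ≡⟨ expand a S ⟩
  a * a + 2 * (a * S) + S * S           ≤⟨ +-mono-≤ (+-monoʳ-≤ (a * a) (cross (f ∘ suc))) (cauchy-schwarz (f ∘ suc)) ⟩
  a * a + (n * (a * a) + Q) + n * Q     ≡⟨ collect a n Q ⟩
  suc n * (a * a + Q)                   ∎
  where
  open ≤-Reasoning
  a = f zero
  S = sum (f ∘ suc)
  Q = sum (λ i → f (suc i) * f (suc i))
  expand : ∀ a S → (a + S) * (a + S) ≡ a * a + 2 * (a * S) + S * S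
  expand = solve-∀
  collect : ∀ a n Q → a * a + (n * (a * a) + Q) + n * Q ≡ (1 + n) * (a * a + Q)
  collect = solve-∀
  cross : ∀ {m} (g : Fin m → ℕ) → 2 * (a * sum g) ≤ m * (a * a) + sum (λ i → g i * g i)
  cross {zero}  g = ≤-reflexive (cong (2 *_) (*-zeroʳ a))
  cross {suc m} g = begin
    2 * (a * (b + T))                     ≡⟨ split a b T ⟩
    2 * (a * b) + 2 * (a * T)             ≤⟨ +-mono-≤ (ab≤a²+b² a b) (cross (g ∘ suc)) ⟩
    a * a + b * b + (m * (a * a) + R)     ≡⟨ regroup a b (m * (a * a)) R ⟩
    a * a + m * (a * a) + (b * b + R)     ∎
    where
    b = g zero
    T = sum (g ∘ suc)
    R = sum (λ i → g (suc i) * g (suc i))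
    split : ∀ a b T → 2 * (a * (b + T)) ≡ 2 * (a * b) + 2 * (a * T)
    split = solve-∀
    regroup : ∀ a b M R → a * a + b * b + (M + R) ≡ a * a + M + (b * b + R)
    regroup = solve-∀

-- Edge counts and degree sums.

module _ {A : Set} {P : A → Set} (P? : ∀ x → Dec (P x)) where

  length-filter : ∀ xs → length (filter P? xs) ≡ sumᴸ (map (ind ∘ P?) xs)
  length-filter [] = refl
  length-filter (x ∷ xs) with P? x
  ... | yes _ = cong suc (length-filter xs)
  ... | no _  = length-filter xs

length-filter-map : ∀ {A B : Set} {P : B → Set} (P? : ∀ y → Dec (P y)) (f : A → B) xs →
                    length (filter P? (map f xs)) ≡ length (filter (P? ∘ f) xs)
length-filter-map P? f [] = refl
length-filter-map P? f (x ∷ xs) with P? (f x)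
... | yes _ = cong suc (length-filter-map P? f xs)
... | no _  = length-filter-map P? f xs

length-filter-× : ∀ {A B : Set} {P : A × B → Set} (P? : ∀ z → Dec (P z)) xs ys →
                  length (filter P? (cartesianProduct xs ys)) ≡
                  sumᴸ (map (λ x → sumᴸ (map (λ y → ind (P? (x , y))) ys)) xs)
length-filter-× P? [] ys = refl
length-filter-× P? (x ∷ xs) ys = begin
  length (filter P? (map (x ,_) ys ++ cartesianProduct xs ys))
    ≡⟨ cong length (filter-++ P? (map (x ,_) ys) _) ⟩
  length (filter P? (map (x ,_) ys) ++ filter P? (cartesianProduct xs ys))
    ≡⟨ length-++ (filter P? (map (x ,_) ys)) ⟩
  length (filter P? (map (x ,_) ys)) + length (filter P? (cartesianProduct xs ys))
    ≡⟨ cong₂ _+_ (trans (length-filter-map P? (x ,_) ys) (length-filter (P? ∘ (x ,_)) ys)) (length-filter-× P? xs ys) ⟩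
  sumᴸ (map (λ y → ind (P? (x , y))) ys) + sumᴸ (map (λ x → sumᴸ (map (λ y → ind (P? (x , y))) ys)) xs) ∎
  where open ≡-Reasoning

degree : Graph n → Fin n → ℕ
degree F w = sum λ x → ind (G._~?_ F w x)

-- Dropping the condition `u <? v` counts each edge from both ends; the factor 2 given away affects
-- only the constant.
edgeCount≤∑degree : (F : Graph n) → edgeCount F ≤ sum (degree F)
edgeCount≤∑degree {n} F = begin
  edgeCount F                                                         ≡⟨ length-filter-× _ (allFin n) (allFin n) ⟩
  sumᴸ (map (λ u → sumᴸ (map (λ v → ind (e? u v)) (allFin n))) (allFin n))  ≡⟨ ∑-allFin (λ u → sumᴸ (map (λ v → ind (e? u v)) (allFin n))) ⟩
  sum (λ u → sumᴸ (map (λ v → ind (e? u v)) (allFin n)))              ≤⟨ ∑-mono (λ u → ≤-reflexive (∑-allFin λ v → ind (e? u v))) ⟩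
  sum (λ u → sum (λ v → ind (e? u v)))                                ≤⟨ ∑-mono (λ u → ∑-mono λ v → ind-mono (e? u v) (G._~?_ F u v) proj₂) ⟩
  sum (degree F)                                                      ∎
  where
  open ≤-Reasoning
  e? : ∀ u v → Dec _
  e? u v = (u <? v) ×-dec (G._~?_ F u v)

-- Walks, their lengths and vertices.

module _ {A : Set} {R : Rel A 0ℓ} where

  len : ∀ {u v} → Star R u v → ℕ
  len ε       = 0
  len (_ ◅ p) = suc (len p)

  len-◅◅ : ∀ {u v w} (p : Star R u v) (q : Star R v w) → len (p ◅◅ q) ≡ len p + len q
  len-◅◅ ε       q = refl
  len-◅◅ (_ ◅ p) q = cong suc (len-◅◅ p q)

  vertices : ∀ {u v} → Star R u v → List A
  vertices {v = v} ε       = v ∷ []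
  vertices {u = u} (_ ◅ p) = u ∷ vertices p

len-map : ∀ {A : Set} {R S : Rel A 0ℓ} (f : ∀ {x y} → R x y → S x y) {u v} (p : Star R u v) →
          ∃[ q ] len {R = S} {u} {v} q ≡ len p
len-map f ε = ε , refl
len-map f (e ◅ p) with len-map f p
... | q , eq = f e ◅ q , cong suc eq

reversed : (F : Graph n) → ∀ {u v} (p : Path F u v) → ∃[ q ] len {R = G._~_ F} {v} {u} q ≡ len p
reversed F ε = ε , refl
reversed F (e ◅ p) with reversed F p
... | q , eq = q ◅◅ (G.sym F e ◅ ε) , trans (len-◅◅ q _) (trans (+-comm (len q) 1) (cong suc eq))

pathLength≡len : (F : Graph n) → ∀ {u v} (p : Path F u v) → pathLength {F = F} p ≡ len p
pathLength≡len F ε       = refl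
pathLength≡len F (_ ◅ p) = cong suc (pathLength≡len F p)

isShortest⇒len : (F : Graph n) → ∀ {u v} (p : Path F u v) → IsShortest {F = F} p → ∀ q → len p ≤ len q
isShortest⇒len F p sh q = subst₂ _≤_ (pathLength≡len F p) (pathLength≡len F q) (sh q)

vertices-start : ∀ {A : Set} {R : Rel A 0ℓ} {u v} (p : Star R u v) → u ∈ vertices p
vertices-start ε       = here refl
vertices-start (_ ◅ _) = here refl

module _ (F : Graph n) where

  ∈-edges⇒∈-vertices : ∀ {u v x y} (p : Path F u v) → (x , y) ∈ edges {F = F} p →
                       x ∈ vertices p × y ∈ vertices p
  ∈-edges⇒∈-vertices (e ◅ p) (here refl) = here refl , there (vertices-start p)
  ∈-edges⇒∈-vertices (e ◅ p) (there m) with ∈-edges⇒∈-vertices p m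
  ... | x∈ , y∈ = there x∈ , there y∈

  module _ {S : Rel (Fin n) 0ℓ} where

    lift : ∀ {u v} (p : Path F u v) → (∀ {x y} → (x , y) ∈ edges {F = F} p → S x y) →
           ∃[ q ] len {R = S} {u} {v} q ≡ len p
    lift ε       f = ε , refl
    lift (e ◅ p) f with lift p (f ∘ there)
    ... | q , eq = f (here refl) ◅ q , cong suc eq

    -- The relation `S` lets the two halves live in any graph that contains the edges of `p`: `F`
    -- itself for shortcuts, the enlarged spanner for `near-gain`.
    split : ∀ {u v w} (p : Path F u v) → (∀ {x y} → (x , y) ∈ edges {F = F} p → S x y) →
            w ∈ vertices p →
            ∃[ p₁ ] ∃[ p₂ ] len {R = S} {u} {w} p₁ + len {R = S} {w} {v} p₂ ≡ len p
    split ε       f (here refl) = ε , ε , refl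
    split (e ◅ p) f (here refl) = ε , lift (e ◅ p) f
    split (e ◅ p) f (there m) with split p (f ∘ there) m
    ... | p₁ , p₂ , eq = f (here refl) ◅ p₁ , p₂ , cong suc eq

-- Neighbours on a shortest path.

sumᴸ-zero : ∀ {A : Set} {f : A → ℕ} xs → (∀ {x} → x ∈ xs → f x ≤ 0) → sumᴸ (map f xs) ≤ 0
sumᴸ-zero []       f≤0 = z≤n
sumᴸ-zero (x ∷ xs) f≤0 = +-mono-≤ (f≤0 (here refl)) (sumᴸ-zero xs (f≤0 ∘ there))

module _ (F : Graph n) (x : Fin n) where

  private
    adj : Fin n → ℕ
    adj w = ind (G._~?_ F w x)

    adj≤1 : ∀ w → adj w ≤ 1
    adj≤1 w = ind≤1 (G._~?_ F w x)

  -- If the first vertex is adjacent to x, any vertex beyond the next two would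
  -- give a shortcut through x.
  neighbours-on-shortest : ∀ {u v} (p : Path F u v) → (∀ (q : Path F u v) → len p ≤ len q) →
                           sumᴸ (map adj (vertices p)) ≤ 3
  neighbours-on-shortest {v = v} ε sh = ≤-trans (+-mono-≤ (adj≤1 v) z≤n) (s≤s z≤n)
  neighbours-on-shortest {u} (e ◅ p) sh with G._~?_ F u x
  -- The tail of a shortest path is again shortest, so a first vertex not adjacent to `x` can be
  -- skipped.
  ... | no _    = neighbours-on-shortest p (λ q → ≤-pred (sh (e ◅ q)))
  ... | yes u~x = s≤s (rest p sh)
    where
    rest : ∀ {b v} (p : Path F b v) → (∀ (q : Path F u v) → suc (len p) ≤ len q) →
           sumᴸ (map adj (vertices p)) ≤ 2
    rest {b} ε        sh = ≤-trans (+-mono-≤ (adj≤1 b) z≤n) (s≤s z≤n)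
    rest {b} (_◅_ {j = c} _ ε) sh = +-mono-≤ (adj≤1 b) (+-mono-≤ (adj≤1 c) z≤n)
    rest {b} (_◅_ {j = c} _ (_ ◅ p)) sh =
      +-mono-≤ (adj≤1 b) (+-mono-≤ (adj≤1 c) (sumᴸ-zero (vertices p) far))
      where
      far : ∀ {w} → w ∈ vertices p → adj w ≤ 0
      far {w} w∈p with G._~?_ F w x
      ... | no _ = z≤n
      ... | yes w~x with split F p (λ m → ∈-edges⇒~ {G = F} p m) w∈p
      ... | p₁ , p₂ , eq = contradiction
        (≤-trans (sh (u~x ◅ G.sym F w~x ◅ p₂)) (+-monoʳ-≤ 2 (≤-trans (m≤n+m (len p₂) (len p₁)) (≤-reflexive eq))))
        (<-irrefl refl)

module _ {n : ℕ} where

  open Membership (_≟_ {n}) using (_∈?_)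

  -- The left side treats `L` as a set; repetitions in the list can only increase the right side.
  ∑-∈≤sumᴸ : ∀ L (f : Fin n → ℕ) → sum (λ w → ind (w ∈? L) * f w) ≤ sumᴸ (map f L)
  ∑-∈≤sumᴸ []      f = ∑-zero {f = λ w → ind (w ∈? []) * f w} (λ _ → z≤n)
  ∑-∈≤sumᴸ (a ∷ L) f = begin
    sum (λ w → ind (w ∈? (a ∷ L)) * f w)
      ≤⟨ ∑-mono (λ w → ≤-trans (*-monoˡ-≤ (f w) (ind-⊎ (w ∈? (a ∷ L)) (w ≟ a) (w ∈? L) λ { (here eq) → inj₁ eq ; (there m) → inj₂ m }))
                               (≤-reflexive (*-distribʳ-+ (f w) (ind (w ≟ a)) _))) ⟩
    sum (λ w → ind (w ≟ a) * f w + ind (w ∈? L) * f w)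
      ≡⟨ ∑-distrib-+ (λ w → ind (w ≟ a) * f w) _ ⟩
    sum (λ w → ind (w ≟ a) * f w) + sum (λ w → ind (w ∈? L) * f w)
      ≤⟨ +-mono-≤ (∑-point a f) (∑-∈≤sumᴸ L f) ⟩
    f a + sumᴸ (map f L) ∎
    where open ≤-Reasoning

-- Bounded walks and truncated distance.

-- Used in place of distances in the growing graph: it is decidable by recursion on `ℓ` and
-- preserved when edges are added.
Within : Graph n → ℕ → Rel (Fin n) 0ℓ
Within F ℓ u v = ∃[ p ] len {R = G._~_ F} {u} {v} p ≤ ℓ

within? : (F : Graph n) → ∀ ℓ u v → Dec (Within F ℓ u v)
within? F zero u v = map′ (λ { refl → ε , z≤n }) (λ { (ε , _) → refl }) (u ≟ v)
within? F (suc ℓ) u v =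
  map′ [ (λ { refl → ε , z≤n }) , (λ { (_ , e , p , p≤ℓ) → e ◅ p , s≤s p≤ℓ }) ]′
       (λ { (ε , _) → inj₁ refl ; (e ◅ p , s≤s p≤ℓ) → inj₂ (_ , e , p , p≤ℓ) })
       ((u ≟ v) ⊎-dec any? (λ y → G._~?_ F u y ×-dec within? F ℓ y v))

-- Equals B when every walk from u to v has length at least B or there is none.
dist : Graph n → ℕ → Fin n → Fin n → ℕ
dist F zero    u v = zero
dist F (suc B) u v with within? F B u v
... | yes _ = dist F B u v
... | no _  = suc B

dist-minimal : (F : Graph n) → ∀ B {u v} (p : Path F u v) → dist F B u v ≤ len p
dist-minimal F zero    p = z≤n
dist-minimal F (suc B) {u} {v} p with within? F B u v
... | yes _ = dist-minimal F B p
... | no ¬w = ≰⇒> λ p≤B → ¬w (p , p≤B)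

dist-attained : (F : Graph n) → ∀ B {u v} → Within F B u v → Within F (dist F B u v) u v
dist-attained F zero    w = w
dist-attained F (suc B) {u} {v} w with within? F B u v
... | yes w′ = dist-attained F B w′
... | no _   = w

-- The potential.

module Potential (F₀ : Graph n) (B : ℕ) where

  -- For a subgraph `F` of `F₀`, and a distance from `a` to `x` in `F₀` of at most `B`, this is 3, 2
  -- or 1 when the distance in `F` is larger by 0, 1 or 2, and 0 otherwise.
  closeness : Graph n → Fin n → Fin n → ℕ
  closeness F a x = sum {3} λ j → ind (within? F (dist F₀ B a x + toℕ j) a x)

  potential : Graph n → ℕ
  potential F = sum λ x → sum λ a → closeness F a x

  potential≤ : ∀ F → potential F ≤ n * (n * 3)
  potential≤ F = ∑-bound λ x → ∑-bound λ a → ∑-bound {3} λ j → ind≤1 (within? F (dist F₀ B a x + toℕ j) a x)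

  module _ (H H′ : Graph n) (H⊆H′ : ∀ {x y} → G._~_ H x y → G._~_ H′ x y) where

    within-mono : ∀ {ℓ a x} → Within H ℓ a x → Within H′ ℓ a x
    within-mono (p , p≤ℓ) with len-map H⊆H′ p
    ... | q , eq = q , ≤-trans (≤-reflexive eq) p≤ℓ

    closeness-mono : ∀ a x → closeness H a x ≤ closeness H′ a x
    closeness-mono a x = ∑-mono {3} λ j →
      ind-mono (within? H (dist F₀ B a x + toℕ j) a x) (within? H′ (dist F₀ B a x + toℕ j) a x) within-mono

    -- As `x` is next to a node of a shortest path, the length `suc (len p₁)` exceeds the distance
    -- from `a` to `x` by at most 2. It is thus one of the three thresholds counted, met by `H′` but
    -- not by `H`.
    closeness-strict : ∀ {a b w x} (p₁ : Path F₀ a w) (p₂ : Path F₀ w b) →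
      (∀ (q : Path F₀ a b) → len p₁ + len p₂ ≤ len q) → suc (len p₁) ≤ B → G._~_ F₀ w x →
      Within H′ (suc (len p₁)) a x → ¬ Within H (suc (len p₁)) a x →
      closeness H a x < closeness H′ a x
    closeness-strict {a} {b} {w} {x} p₁ p₂ sh p₁<B w~x W′ ¬W =
      ∑-strict {3} (λ j → ind-mono (within? H (d + toℕ j) a x) (within? H′ (d + toℕ j) a x) within-mono)
        j (ind-strict (within? H (d + toℕ j) a x) (within? H′ (d + toℕ j) a x)
             (¬W ∘ subst (λ ℓ → Within H ℓ a x) d+j) (subst (λ ℓ → Within H′ ℓ a x) (sym d+j) W′))
      where
      open ≤-Reasoning
      d = dist F₀ B a x
      ℓ = suc (len p₁)

      len-via : len (p₁ ◅◅ w~x ◅ ε) ≡ ℓ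
      len-via = trans (len-◅◅ p₁ _) (+-comm (len p₁) 1)

      d≤ℓ : d ≤ ℓ
      d≤ℓ = ≤-trans (dist-minimal F₀ B (p₁ ◅◅ w~x ◅ ε)) (≤-reflexive len-via)

      -- A shortest walk from `a` to `x`, the edge back to `w` and then `p₂` cannot beat the
      -- shortest path from `a` to `b`. The bound `p₁<B` ensures that `d` is attained by a walk and
      -- is not merely the cutoff.
      ℓ≤2+d : ℓ ≤ 2 + d
      ℓ≤2+d with dist-attained F₀ B (p₁ ◅◅ w~x ◅ ε , ≤-trans (≤-reflexive len-via) p₁<B)
      ... | q , q≤d = s≤s (+-cancelʳ-≤ (len p₂) _ _ (begin
        len p₁ + len p₂                      ≤⟨ sh (q ◅◅ G.sym F₀ w~x ◅ p₂) ⟩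
        len (q ◅◅ G.sym F₀ w~x ◅ p₂)         ≡⟨ len-◅◅ q _ ⟩
        len q + suc (len p₂)                 ≡⟨ +-suc (len q) (len p₂) ⟩
        suc (len q) + len p₂                 ≤⟨ +-monoˡ-≤ (len p₂) (s≤s q≤d) ⟩
        suc d + len p₂                       ∎))

      j<3 : ℓ ∸ d < 3
      j<3 = s≤s (≤-trans (∸-monoˡ-≤ d ℓ≤2+d) (≤-reflexive (m+n∸n≡m 2 d)))

      j = fromℕ< j<3

      d+j : d + toℕ j ≡ ℓ
      d+j = trans (cong (d +_) (toℕ-fromℕ< j<3)) (m+[n∸m]≡n d≤ℓ)

-- Growth of the squared degrees in one step.

∑degree² : Graph n → ℕ
∑degree² F = sum λ w → degree F w * degree F w

module _ (F₀ H : Graph n) (H⊆F₀ : ∀ {x y} → G._~_ H x y → G._~_ F₀ x y)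
         {u v : Fin n} (p : Path F₀ u v) (shortest : ∀ (q : Path F₀ u v) → len p ≤ len q) where

  open Membership (_≟_ {n}) using (_∈?_)

  private
    H′ = addPath F₀ H p
    V  = vertices p

  addPath-⊆ : ∀ {x y} → G._~_ H′ x y → G._~_ F₀ x y
  addPath-⊆ (inj₁ e)        = H⊆F₀ e
  addPath-⊆ (inj₂ (inj₁ m)) = ∈-edges⇒~ {G = F₀} p m
  addPath-⊆ (inj₂ (inj₂ m)) = G.sym F₀ (∈-edges⇒~ {G = F₀} p m)

  -- Membership in the neighbourhood N of the path.
  Near : Fin n → Set
  Near x = Any (λ w → G._~_ H′ w x) V

  near? : ∀ x → Dec (Near x)
  near? x = Any.any? (λ w → G._~?_ H′ w x) V

  incidence≤3 : ∀ x → sum (λ w → ind (w ∈? V) * ind (G._~?_ F₀ w x)) ≤ 3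
  incidence≤3 x = ≤-trans (∑-∈≤sumᴸ V _) (neighbours-on-shortest F₀ x p shortest)

  -- An added edge at `w` leads to a node of `p` adjacent to `w` in `F₀`, and a shortest path has at
  -- most 3 of these.
  degree-on-path : ∀ w → degree H′ w ≤ degree H w + 3
  degree-on-path w = begin
    degree H′ w
      ≤⟨ ∑-mono (λ x → ≤-trans
           (ind-⊎ (G._~?_ H′ w x) (G._~?_ H w x) ((x ∈? V) ×-dec G._~?_ F₀ x w) (cases x))
           (+-monoʳ-≤ (ind (G._~?_ H w x)) (ind-× (x ∈? V) (G._~?_ F₀ x w)))) ⟩
    sum (λ x → ind (G._~?_ H w x) + ind (x ∈? V) * ind (G._~?_ F₀ x w))
      ≡⟨ ∑-distrib-+ (λ x → ind (G._~?_ H w x)) _ ⟩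
    degree H w + sum (λ x → ind (x ∈? V) * ind (G._~?_ F₀ x w))
      ≤⟨ +-monoʳ-≤ (degree H w) (incidence≤3 w) ⟩
    degree H w + 3 ∎
    where
    open ≤-Reasoning
    cases : ∀ x → G._~_ H′ w x → G._~_ H w x ⊎ (x ∈ V × G._~_ F₀ x w)
    cases x (inj₁ e)        = inj₁ e
    cases x (inj₂ (inj₁ m)) = inj₂ (proj₂ (∈-edges⇒∈-vertices F₀ p m) , G.sym F₀ (∈-edges⇒~ {G = F₀} p m))
    cases x (inj₂ (inj₂ m)) = inj₂ (proj₁ (∈-edges⇒∈-vertices F₀ p m) , ∈-edges⇒~ {G = F₀} p m)

  degree-off-path : ∀ w → ¬ w ∈ V → degree H′ w ≤ degree H w
  degree-off-path w w∉V = ∑-mono λ x → ind-mono (G._~?_ H′ w x) (G._~?_ H w x) λ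
    { (inj₁ e)        → e
    ; (inj₂ (inj₁ m)) → contradiction (proj₁ (∈-edges⇒∈-vertices F₀ p m)) w∉V
    ; (inj₂ (inj₂ m)) → contradiction (proj₂ (∈-edges⇒∈-vertices F₀ p m)) w∉V }

  degree-mono : ∀ w → degree H w ≤ degree H′ w
  degree-mono w = ∑-mono λ x → ind-mono (G._~?_ H w x) (G._~?_ H′ w x) inj₁

  -- On the path, with old degree a and new degree b, a ≤ b ≤ a + 3 gives b² ≤ a² + 3a + 3b ≤ a² +
  -- 6b. The increment is kept in terms of b so that `∑degree-on-path` can bound its sum.
  degree²-growth : ∀ w → degree H′ w * degree H′ w ≤
                         degree H w * degree H w + 6 * (ind (w ∈? V) * degree H′ w)
  degree²-growth w with w ∈? V
  ... | no w∉V = ≤-trans (*-mono-≤ (degree-off-path w w∉V) (degree-off-path w w∉V)) (m≤m+n _ _)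
  ... | yes _  = begin
    b * b                    ≤⟨ *-monoˡ-≤ b (degree-on-path w) ⟩
    (a + 3) * b              ≡⟨ *-distribʳ-+ b a 3 ⟩
    a * b + 3 * b            ≤⟨ +-monoˡ-≤ (3 * b) (*-monoʳ-≤ a (degree-on-path w)) ⟩
    a * (a + 3) + 3 * b      ≡⟨ e₁ a b ⟩
    a * a + 3 * a + 3 * b    ≤⟨ +-monoˡ-≤ (3 * b) (+-monoʳ-≤ (a * a) (*-monoʳ-≤ 3 (degree-mono w))) ⟩
    a * a + 3 * b + 3 * b    ≡⟨ e₂ (a * a) b ⟩
    a * a + 6 * (1 * b)      ∎
    where
    open ≤-Reasoning
    a = degree H w
    b = degree H′ w
    e₁ : ∀ a b → a * (a + 3) + 3 * b ≡ a * a + 3 * a + 3 * b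
    e₁ = solve-∀
    e₂ : ∀ c b → c + 3 * b + 3 * b ≡ c + 6 * (1 * b)
    e₂ = solve-∀

  -- Double counting of pairs of a node `w` on the path and a neighbour `x` of it in `H′`: the
  -- column of `x` is zero unless `x` is near, and then has at most 3 entries.
  ∑degree-on-path : sum (λ w → ind (w ∈? V) * degree H′ w) ≤ 3 * sum (ind ∘ near?)
  ∑degree-on-path = begin
    sum (λ w → ind (w ∈? V) * degree H′ w)
      ≤⟨ ∑-mono (λ w → ≤-reflexive (*-distribˡ-sum (ind (w ∈? V)) (λ x → ind (G._~?_ H′ w x)))) ⟩
    sum (λ w → sum (λ x → t w x))   ≡⟨ ∑-comm t ⟩
    sum (λ x → sum (λ w → t w x))   ≤⟨ ∑-mono column ⟩
    sum (λ x → 3 * ind (near? x))   ≡⟨ *-distribˡ-sum 3 (ind ∘ near?) ⟨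
    3 * sum (ind ∘ near?)           ∎
    where
    open ≤-Reasoning
    t : Fin n → Fin n → ℕ
    t w x = ind (w ∈? V) * ind (G._~?_ H′ w x)

    column : ∀ x → sum (λ w → t w x) ≤ 3 * ind (near? x)
    column x with near? x
    ... | yes _  = ≤-trans (∑-mono λ w → *-monoʳ-≤ (ind (w ∈? V)) (ind-mono (G._~?_ H′ w x) (G._~?_ F₀ w x) addPath-⊆))
                           (incidence≤3 x)
    ... | no ¬nr = ∑-zero absent
      where
      absent : ∀ w → t w x ≤ 0
      absent w with w ∈? V | G._~?_ H′ w x
      ... | no _    | _       = z≤n
      ... | yes _   | no _    = z≤n
      ... | yes w∈V | yes w~x = contradiction (lose w∈V w~x) ¬nr

  ∑degree²-growth : ∑degree² H′ ≤ ∑degree² H + 18 * sum (ind ∘ near?)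
  ∑degree²-growth = begin
    ∑degree² H′                                                    ≤⟨ ∑-mono degree²-growth ⟩
    sum (λ w → degree H w * degree H w + 6 * t w)                  ≡⟨ ∑-distrib-+ (λ w → degree H w * degree H w) _ ⟩
    ∑degree² H + sum (λ w → 6 * t w)                               ≡⟨ cong (∑degree² H +_) (*-distribˡ-sum 6 t) ⟨
    ∑degree² H + 6 * sum t                                         ≤⟨ +-monoʳ-≤ (∑degree² H) (*-monoʳ-≤ 6 ∑degree-on-path) ⟩
    ∑degree² H + 6 * (3 * sum (ind ∘ near?))                       ≡⟨ cong (∑degree² H +_) (*-assoc 6 3 (sum (ind ∘ near?))) ⟨
    ∑degree² H + 18 * sum (ind ∘ near?)                            ∎
    where
    open ≤-Reasoning
    t : Fin n → ℕ
    t w = ind (w ∈? V) * degree H′ w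

  -- Growth of the potential in one step.

  module _ (far : ∀ (q : Path H u v) → len p + 2 < len q) (B : ℕ) (p<B : len p < B) where

    open Potential F₀ B

    -- H′ has walks from x to u and to v of total length at most len p + 2, so
    -- H cannot have both.
    gain : ∀ {w x} (q₁ : Path H′ u w) (q₂ : Path H′ w v) → len q₁ + len q₂ ≡ len p →
           G._~_ H′ w x → ∃[ a ] closeness H a x < closeness H′ a x
    gain {w} {x} q₁ q₂ eq w~x
      with len-map addPath-⊆ q₁ | len-map addPath-⊆ q₂ | reversed H′ q₂
    ... | p₁ , p₁≡q₁ | p₂ , p₂≡q₂ | r₂ , r₂≡q₂
      with reversed F₀ p₁ | reversed F₀ p₂
    ... | s₁ , s₁≡p₁ | s₂ , s₂≡p₂
      with within? H (suc (len p₁)) u x | within? H (suc (len s₂)) v x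
    ... | no ¬W | _ = u , closeness-strict H H′ inj₁ p₁ p₂ sh p₁<B (addPath-⊆ w~x) W′ ¬W
      where
      p₁+p₂≡p : len p₁ + len p₂ ≡ len p
      p₁+p₂≡p = trans (cong₂ _+_ p₁≡q₁ p₂≡q₂) eq
      sh : ∀ q → len p₁ + len p₂ ≤ len q
      sh q = ≤-trans (≤-reflexive p₁+p₂≡p) (shortest q)
      p₁<B : len p₁ < B
      p₁<B = ≤-<-trans (≤-trans (m≤m+n (len p₁) (len p₂)) (≤-reflexive p₁+p₂≡p)) p<B
      W′ : Within H′ (suc (len p₁)) u x
      W′ = q₁ ◅◅ w~x ◅ ε , ≤-reflexive (trans (len-◅◅ q₁ _) (trans (+-comm (len q₁) 1) (cong suc (sym p₁≡q₁))))
    -- Mirror image of the previous case: the path is read from `v` to `u`, with `s₂` as its initial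
    -- part.
    ... | yes _ | no ¬W = v , closeness-strict H H′ inj₁ s₂ s₁ sh s₂<B (addPath-⊆ w~x) W′ ¬W
      where
      s₂+s₁≡p : len s₂ + len s₁ ≡ len p
      s₂+s₁≡p = trans (+-comm (len s₂) (len s₁)) (trans (cong₂ _+_ (trans s₁≡p₁ p₁≡q₁) (trans s₂≡p₂ p₂≡q₂)) eq)
      sh : ∀ q → len s₂ + len s₁ ≤ len q
      sh q with reversed F₀ q
      ... | q′ , q′≡q = ≤-trans (≤-reflexive s₂+s₁≡p) (≤-trans (shortest q′) (≤-reflexive q′≡q))
      s₂<B : len s₂ < B
      s₂<B = ≤-<-trans (≤-trans (m≤m+n (len s₂) (len s₁)) (≤-reflexive s₂+s₁≡p)) p<B
      W′ : Within H′ (suc (len s₂)) v x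
      W′ = r₂ ◅◅ w~x ◅ ε , ≤-reflexive (trans (len-◅◅ r₂ _) (trans (+-comm (len r₂) 1)
             (cong suc (trans r₂≡q₂ (sym (trans s₂≡p₂ p₂≡q₂))))))
    ... | yes (t₁ , t₁≤) | yes (t₂ , t₂≤) with reversed H t₂
    ... | t₂′ , t₂′≡t₂ = contradiction (far (t₁ ◅◅ t₂′)) (≤⇒≯ (begin
      len (t₁ ◅◅ t₂′)               ≡⟨ len-◅◅ t₁ t₂′ ⟩
      len t₁ + len t₂′              ≤⟨ +-mono-≤ t₁≤ (≤-trans (≤-reflexive t₂′≡t₂) t₂≤) ⟩
      suc (len p₁) + suc (len s₂)   ≡⟨ cong₂ (λ i j → suc i + suc j) p₁≡q₁ (trans s₂≡p₂ p₂≡q₂) ⟩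
      suc (len q₁) + suc (len q₂)   ≡⟨ shuffle (len q₁) (len q₂) ⟩
      len q₁ + len q₂ + 2           ≡⟨ cong (_+ 2) eq ⟩
      len p + 2                     ∎))
      where
      open ≤-Reasoning
      shuffle : ∀ i j → suc i + suc j ≡ i + j + 2
      shuffle = solve-∀

    -- No source `a` loses closeness to `x`, and if `x` is near, cutting the path at a neighbour of
    -- `x` yields one source that strictly gains.
    near-gain : ∀ x → ind (near? x) + sum (λ a → closeness H a x) ≤ sum (λ a → closeness H′ a x)
    near-gain x with near? x
    ... | no _   = ∑-mono λ a → closeness-mono H H′ inj₁ a x
    ... | yes nr with find nr
    ... | w , w∈V , w~x with split F₀ {S = G._~_ H′} p (λ m → inj₂ (inj₁ m)) w∈V
    ... | q₁ , q₂ , eq with gain q₁ q₂ eq w~x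
    ... | a , a-gains = ∑-strict (λ a → closeness-mono H H′ inj₁ a x) a a-gains

    -- The difference of `∑degree²` and 18 times the potential does not increase: the former grows
    -- by at most 18 |N|, the potential by at least |N|. Terms are moved across to avoid
    -- subtraction.
    step-bound : ∑degree² H′ + 18 * potential H ≤ ∑degree² H + 18 * potential H′
    step-bound = begin
      ∑degree² H′ + 18 * potential H                            ≤⟨ +-monoˡ-≤ (18 * potential H) ∑degree²-growth ⟩
      ∑degree² H + 18 * N + 18 * potential H                    ≡⟨ shuffle (∑degree² H) N (potential H) ⟩
      ∑degree² H + 18 * (N + potential H)                       ≡⟨ cong (λ s → ∑degree² H + 18 * s) (∑-distrib-+ (ind ∘ near?) _) ⟨
      ∑degree² H + 18 * sum (λ x → ind (near? x) + sum (λ a → closeness H a x))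
                                                                ≤⟨ +-monoʳ-≤ (∑degree² H) (*-monoʳ-≤ 18 (∑-mono near-gain)) ⟩
      ∑degree² H + 18 * potential H′                            ∎
      where
      open ≤-Reasoning
      N = sum (ind ∘ near?)
      shuffle : ∀ d N P → d + 18 * N + 18 * P ≡ d + 18 * (N + P)
      shuffle = solve-∀

-- The whole run and the final bound.

-- Infinite distances are harmless: one in `H` contradicts the existence of `q`, one in `F` that of
-- `p`.
violation⇒far : (F H : Graph n) {u v : Fin n} → Violates 2 F H u v →
                (p : Path F u v) → IsShortest {F = F} p → (q : Path H u v) → len p + 2 < len q
violation⇒far F H ([ d ] , ⊤⁺ , _ , ¬q , _) p sh q = contradiction q ¬q
violation⇒far F H (⊤⁺ , _ , ¬p , _ , _) p sh q = contradiction p ¬p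
violation⇒far F H ([ d ] , [ d′ ] , (p₀ , _ , p₀≡d) , (q₀ , q₀-sh , q₀≡d′) , [ d+2<d′ ]) p sh q = begin-strict
  len p + 2                     ≡⟨ cong (_+ 2) (pathLength≡len F p) ⟨
  pathLength {F = F} p + 2      ≤⟨ +-monoˡ-≤ 2 (≤-trans (sh p₀) (≤-reflexive p₀≡d)) ⟩
  d + 2                         <⟨ d+2<d′ ⟩
  d′                            ≡⟨ q₀≡d′ ⟨
  pathLength {F = H} q₀         ≤⟨ q₀-sh q ⟩
  pathLength {F = H} q          ≡⟨ pathLength≡len H q ⟩
  len q                         ∎
  where open ≤-Reasoning

-- Summing `step-bound` over the run needs one cutoff for all steps, larger than the length of every
-- added path. Asking for all sufficiently large `B` lets the induction take the maximum.
completion-bound : (F H H′ : Graph n) → (∀ {x y} → G._~_ H x y → G._~_ F x y) → Star (Step 2 F) H H′ →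
  ∃[ B₀ ] ∀ B → B₀ ≤ B →
  ∑degree² H′ + 18 * Potential.potential F B H ≤ ∑degree² H + 18 * Potential.potential F B H′
completion-bound F H H′ H⊆F ε = 0 , λ _ _ → ≤-refl
completion-bound F H H′ H⊆F (step viol p sh ◅ steps)
  with completion-bound F (addPath F H p) H′ (addPath-⊆ F H H⊆F p (isShortest⇒len F p sh)) steps
... | B₀ , bound = suc (len p) ⊔ B₀ , λ B B₀≤B →
  telescope (∑degree² H) (∑degree² (addPath F H p)) (∑degree² H′)
    (step-bound F H H⊆F p (isShortest⇒len F p sh) (violation⇒far F H viol p sh) B (m⊔n≤o⇒m≤o (suc (len p)) B₀ B₀≤B))
    (bound B (m⊔n≤o⇒n≤o (suc (len p)) B₀ B₀≤B))
  where
  telescope : ∀ d₀ d₁ d₂ {s₀ s₁ s₂} → d₁ + s₀ ≤ d₀ + s₁ → d₂ + s₁ ≤ d₁ + s₂ → d₂ + s₀ ≤ d₀ + s₂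
  telescope d₀ d₁ d₂ {s₀} {s₁} {s₂} le₁ le₂ = +-cancelʳ-≤ (d₁ + s₁) _ _ (begin
    d₂ + s₀ + (d₁ + s₁)     ≡⟨ regroup d₂ s₀ d₁ s₁ ⟩
    d₁ + s₀ + (d₂ + s₁)     ≤⟨ +-mono-≤ le₁ le₂ ⟩
    d₀ + s₁ + (d₁ + s₂)     ≡⟨ regroup′ d₀ s₁ d₁ s₂ ⟩
    d₀ + s₂ + (d₁ + s₁)     ∎)
    where
    open ≤-Reasoning
    regroup : ∀ a b c d → a + b + (c + d) ≡ c + b + (a + d)
    regroup = solve-∀
    regroup′ : ∀ a b c d → a + b + (c + d) ≡ a + d + (c + b)
    regroup′ = solve-∀

∑degree²-empty : ∀ n → ∑degree² (empty n) ≤ 0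
∑degree²-empty n = ∑-zero λ w → *-monoˡ-≤ (degree (empty n) w) (isolated w)
  where
  isolated : ∀ w → degree (empty n) w ≤ 0
  isolated w = ∑-zero {f = λ x → ind (G._~?_ (empty n) w x)} λ _ → z≤n

-- The bound c n^(3/2) is squared on both sides to stay within the natural numbers.
theorem2 : ∃[ c ] (∀ (n : ℕ) (G H : Graph n) →
    SpannerCompletion 2 G (empty n) H →
    edgeCount H ^ 2 ≤ c ^ 2 * n ^ 3)
theorem2 = 8 , λ n G H (steps , _) →
  let B , bound = completion-bound G (empty n) H (λ ()) steps
      Ψ = Potential.potential G B
      open ≤-Reasoning
  in begin
  edgeCount H ^ 2                       ≤⟨ ^-monoˡ-≤ 2 (edgeCount≤∑degree H) ⟩
  sum (degree H) ^ 2                    ≡⟨ cong (sum (degree H) *_) (*-identityʳ _) ⟩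
  sum (degree H) * sum (degree H)       ≤⟨ cauchy-schwarz (degree H) ⟩
  -- The potential of the empty graph is added so that `bound` applies.
  n * ∑degree² H                        ≤⟨ *-monoʳ-≤ n (m≤m+n (∑degree² H) (18 * Ψ (empty n))) ⟩
  n * (∑degree² H + 18 * Ψ (empty n))   ≤⟨ *-monoʳ-≤ n (bound B ≤-refl) ⟩
  n * (∑degree² (empty n) + 18 * Ψ H)   ≤⟨ *-monoʳ-≤ n (+-monoˡ-≤ (18 * Ψ H) (∑degree²-empty n)) ⟩
  n * (18 * Ψ H)                        ≤⟨ *-monoʳ-≤ n (*-monoʳ-≤ 18 (Potential.potential≤ G B H)) ⟩
  n * (18 * (n * (n * 3)))              ≡⟨ cube n ⟩
  -- Here 54 = 18 · 3 is rounded up to the square 64.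
  54 * n ^ 3                            ≤⟨ *-monoˡ-≤ (n ^ 3) (m≤m+n 54 10) ⟩
  8 ^ 2 * n ^ 3                         ∎
  where
  cube : ∀ n → n * (18 * (n * (n * 3))) ≡ 54 * (n * (n * (n * 1)))
  cube = solve-∀
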